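{- Let $k\ge 3$ and $1\le \ell\le k-1$ be integers, and let $F$ be a $k$-graph. If $\pi_\ell(F)=0$, then $F$ is layered.
   Context: A $k$-graph is a finite $k$-uniform hypergraph: a finite vertex set $V(F)$ together with a set $E(F)$ of $k$-element subsets of $V(F)$ called edges. A $k$-graph $H$ is $F$-free if it contains no (not necessarily induced) subhypergraph isomorphic to $F$. Layered: for a function $f:V(F)\to\mathbb N$ and $e\in E(F)$, let $f(e)$ denote the multiset $\{f(v):v\in e\}$. The function $f$ is a layered function of $F$ if (A1) each edge has exactly one vertex whose label is the maximum within the edge; and (A2) if $e,e'\in E(F)$ satisfy $\max f(e)=\max f(e')$, then $f(e)=f(e')$ as multisets. A $k$-graph is layered if it has a layered function. $\ell$-degree Turán density: for a $k$-graph $H$ and $S\subseteq V(H)$, $d_H(S)$ is the number of edges of $H$ containing $S$. The minimum $\ell$-degree $\delta_\ell(H)$ is the minimum of $d_H(S)$ over all $\ell$-subsets $S$ of $V(H)$. The $\ell$-degree Turán number $\mathrm{ex}_\ell(n,F)$ is the maximum of $\delta_\ell(H)$ over all $n$-vertex $F$-free $k$-graphs $H$, and $$\pi_\ell(F)=\lim_{n\to\infty}\frac{\mathrm{ex}_\ell(n,F)}{\binom{n}{k-\ell}};$$ it is known that this limit always exists. -}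

module Defs where

open import Data.Bool using (true; false)
open import Data.Fin using (Fin)
open import Data.Fin.Base using (finToFun; funToFin)
import Data.Fin.Properties as Finₚ
open import Data.Fin.Subset using (Subset; ∣_∣; _∈_; _⊆_)
open import Data.Fin.Subset.Properties using (_∈?_; _⊆?_)
import Data.Integer as ℤ
open import Data.List using (List; []; _∷_; _++_; map; filter; length; allFin)
open import Data.List.Extrema.Nat using (max; min)
import Data.List.Membership.Propositional as Mem
import Data.List.Membership.DecPropositional as DecMem
open import Data.List.Membership.Propositional.Properties using (∈-map⁻)
open import Data.List.Relation.Binary.Permutation.Propositional using (_↭_)
import Data.List.Relation.Binary.Sublist.Propositional as Sub
open import Data.List.Relation.Binary.Sublist.Propositional.Properties using (All-resp-⊆)
open import Data.List.Relation.Unary.All as All using (All)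
import Data.List.Relation.Unary.All.Properties as Allₚ
open import Data.List.Relation.Unary.AllPairs using ([]; _∷_)
open import Data.List.Relation.Unary.Unique.Propositional using (Unique)
import Data.List.Relation.Unary.Unique.Propositional.Properties as Uniqueₚ
open import Data.Nat using (ℕ; zero; suc; _≥_; _∸_)
import Data.Nat.Properties as ℕₚ
open import Data.Nat.Combinatorics using (_C_)
open import Data.Product using (∃-syntax; ∃!; _×_; _,_)
open import Data.Rational as ℚ using (ℚ; 0ℚ)
open import Data.Vec using ([]; _∷_; tabulate)
import Data.Vec.Properties as Vecₚ
import Data.Bool.Properties as Boolₚ
open import Function using (_∘_; mk⇔; Injective)
open import Relation.Binary.PropositionalEquality
  using (_≡_; _≗_; refl; sym; trans; cong; subst)
open import Relation.Nullary using (¬_; Dec; does; ¬?)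
open import Relation.Nullary.Decidable using (map′; _×-dec_; _→-dec_; does-⇔)
open import Relation.Unary using (Decidable)

record KGraph (k n : ℕ) : Set where
  field
    edges    : List (Subset n)
    uniform  : All (λ e → ∣ e ∣ ≡ k) edges
    distinct : Unique edges

open KGraph public

infix 4 _∈ᴱ_
_∈ᴱ_ : ∀ {k n} → Subset n → KGraph k n → Set
e ∈ᴱ H = e Mem.∈ edges H

------------------------------------------------------------------------
-- Layered k-graphs

elements : ∀ {n} → Subset n → List (Fin n)
elements {n} e = filter (_∈? e) (allFin n)

-- The multiset f(e), as a list to be compared up to permutation.
labels : ∀ {n} → (Fin n → ℕ) → Subset n → List ℕ
labels f e = map f (elements e)

-- For an empty edge this is 0.
maxLabel : ∀ {n} → (Fin n → ℕ) → Subset n → ℕ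
maxLabel f e = max 0 (labels f e)

record IsLayeredFunction {k n} (F : KGraph k n) (f : Fin n → ℕ) : Set where
  field
    uniqueMax  : ∀ {e} → e ∈ᴱ F → ∃! _≡_ λ x → x ∈ e × f x ≡ maxLabel f e
    sameLabels : ∀ {e e′} → e ∈ᴱ F → e′ ∈ᴱ F →
                 maxLabel f e ≡ maxLabel f e′ → labels f e ↭ labels f e′

Layered : ∀ {k n} → KGraph k n → Set
Layered F = ∃[ f ] IsLayeredFunction F f

------------------------------------------------------------------------
-- Enumerating the k-graphs on n vertices

subsets : ∀ n → List (Subset n)
subsets zero    = [] ∷ []
subsets (suc n) = map (true ∷_) (subsets n) ++ map (false ∷_) (subsets n)

subsets-unique : ∀ n → Unique (subsets n)
subsets-unique zero    = All.[] ∷ []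
subsets-unique (suc n) =
  Uniqueₚ.++⁺ (Uniqueₚ.map⁺ Vecₚ.∷-injectiveʳ (subsets-unique n))
              (Uniqueₚ.map⁺ Vecₚ.∷-injectiveʳ (subsets-unique n))
              λ (p , q) → disjoint (∈-map⁻ (true ∷_) p) (∈-map⁻ (false ∷_) q)
  where
  disjoint : ∀ {s : Subset (suc n)} →
             ∃[ t ] (t Mem.∈ subsets n × s ≡ true ∷ t) →
             ¬ (∃[ t ] (t Mem.∈ subsets n × s ≡ false ∷ t))
  disjoint (_ , _ , refl) (_ , _ , ())

subsetsOfSize : ∀ m n → List (Subset n)
subsetsOfSize m n = filter (λ s → ∣ s ∣ ℕₚ.≟ m) (subsets n)

sublists : ∀ {A : Set} (xs : List A) → List (∃[ ys ] (ys Sub.⊆ xs))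
sublists []       = ([] , Sub.[]) ∷ []
sublists (x ∷ xs) = map (λ (ys , τ) → x ∷ ys , refl Sub.∷ τ) (sublists xs)
                 ++ map (λ (ys , τ) → ys , x Sub.∷ʳ τ) (sublists xs)

Unique-resp-⊆ : ∀ {A : Set} {xs ys : List A} → ys Sub.⊆ xs → Unique xs → Unique ys
Unique-resp-⊆ Sub.[]           []       = []
Unique-resp-⊆ (_ Sub.∷ʳ τ)     (_ ∷ us) = Unique-resp-⊆ τ us
Unique-resp-⊆ (refl Sub.∷ τ)   (u ∷ us) = All-resp-⊆ τ u ∷ Unique-resp-⊆ τ us

-- Each set of k-subsets of Fin n occurs exactly once as an edge set, listed
-- in the order of subsetsOfSize k n.
kGraphs : ∀ k n → List (KGraph k n)
kGraphs k n = map toKGraph (sublists (subsetsOfSize k n))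
  where
  toKGraph : ∃[ es ] (es Sub.⊆ subsetsOfSize k n) → KGraph k n
  toKGraph (es , τ) = record
    { edges    = es
    ; uniform  = All-resp-⊆ τ (Allₚ.all-filter (λ s → ∣ s ∣ ℕₚ.≟ k) (subsets n))
    ; distinct = Unique-resp-⊆ τ
                   (Uniqueₚ.filter⁺ (λ s → ∣ s ∣ ℕₚ.≟ k) (subsets-unique n))
    }

------------------------------------------------------------------------
-- Containment and F-freeness

hits? : ∀ {v n} (φ : Fin v → Fin n) (e : Subset v) (y : Fin n) →
        Dec (∃[ x ] (x ∈ e × φ x ≡ y))
hits? φ e y = Finₚ.any? λ x → x ∈? e ×-dec φ x Finₚ.≟ y

image : ∀ {v n} → (Fin v → Fin n) → Subset v → Subset n
image φ e = tabulate λ y → does (hits? φ e y)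

record IsEmbedding {k v n} (F : KGraph k v) (H : KGraph k n)
                   (φ : Fin v → Fin n) : Set where
  constructor embedding
  field
    injective      : Injective _≡_ _≡_ φ
    preservesEdges : All (λ e → image φ e ∈ᴱ H) (edges F)

-- Some (not necessarily induced) subhypergraph of H is isomorphic to F.
Contains : ∀ {k v n} → KGraph k n → KGraph k v → Set
Contains H F = ∃[ φ ] IsEmbedding F H φ

Free : ∀ {k v n} → KGraph k v → KGraph k n → Set
Free F H = ¬ Contains H F

image-cong : ∀ {v n} {φ ψ : Fin v → Fin n} → φ ≗ ψ → image φ ≗ image ψ
image-cong {φ = φ} {ψ} φ≗ψ e = Vecₚ.tabulate-cong λ y →
  does-⇔ (mk⇔ (λ (x , x∈e , p) → x , x∈e , trans (sym (φ≗ψ x)) p)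
              (λ (x , x∈e , p) → x , x∈e , trans (φ≗ψ x) p))
         (hits? φ e y) (hits? ψ e y)

module _ {k v n} (F : KGraph k v) (H : KGraph k n) where

  IsEmbedding-resp-≗ : ∀ {φ ψ} → φ ≗ ψ → IsEmbedding F H φ → IsEmbedding F H ψ
  IsEmbedding-resp-≗ φ≗ψ (embedding inj pres) = embedding
    (λ {i} {j} p → inj (trans (φ≗ψ i) (trans p (sym (φ≗ψ j)))))
    (All.map (λ {e} → subst (_∈ᴱ H) (image-cong φ≗ψ e)) pres)

  isEmbedding? : Decidable (IsEmbedding F H)
  isEmbedding? φ = map′
    (λ (inj , pres) → embedding (λ {i} {j} → inj i j) pres)
    (λ (embedding inj pres) → (λ i j → inj {i} {j}) , pres)
    ((Finₚ.all? λ i → Finₚ.all? λ j → φ i Finₚ.≟ φ j →-dec i Finₚ.≟ j)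
      ×-dec All.all? (λ e → image φ e ∈ˡ? edges H) (edges F))
    where open DecMem (Vecₚ.≡-dec Boolₚ._≟_) using () renaming (_∈?_ to _∈ˡ?_)

  contains? : Dec (Contains H F)
  contains? = map′
    (λ (i , emb) → finToFun i , emb)
    (λ (φ , emb) → funToFin φ ,
       IsEmbedding-resp-≗ (sym ∘ Finₚ.finToFun-funToFin φ) emb)
    (Finₚ.any? (isEmbedding? ∘ finToFun))

free? : ∀ {k v n} (F : KGraph k v) → Decidable (Free {n = n} F)
free? F H = ¬? (contains? F H)

------------------------------------------------------------------------
-- ℓ-degree Turán density

degree : ∀ {k n} → KGraph k n → Subset n → ℕ
degree H S = length (filter (S ⊆?_) (edges H))

-- No degree exceeds the number of edges, so starting the minimum there affects
-- it only when there are no ℓ-subsets, that is, when n < ℓ.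
minDegree : ∀ {k n} → ℕ → KGraph k n → ℕ
minDegree {n = n} ℓ H =
  min (length (edges H)) (map (degree H) (subsetsOfSize ℓ n))

-- The value is 0 if there is no F-free k-graph on n vertices, which happens
-- only if F has no edges.
ex : ∀ {k v} → ℕ → ℕ → KGraph k v → ℕ
ex {k} ℓ n F = max 0 (map (minDegree ℓ) (filter (free? F) (kGraphs k n)))

-- a / b in ℚ, and 0 when b = 0.
ratio : ℕ → ℕ → ℚ
ratio a zero    = 0ℚ
ratio a (suc b) = ℤ.+ a ℚ./ suc b

ConvergesTo : (ℕ → ℚ) → ℚ → Set
ConvergesTo a L =
  ∀ ε → 0ℚ ℚ.< ε → ∃[ N ] (∀ n → n ≥ N → ℚ.∣ a n ℚ.- L ∣ ℚ.< ε)

-- π_ℓ(F) = L, for rational L. The binomial coefficient vanishes only for the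
-- finitely many n < k ∸ ℓ.
HasTuránDensity : ∀ {k v} → ℕ → KGraph k v → ℚ → Set
HasTuránDensity {k} ℓ F L = ConvergesTo (λ n → ratio (ex ℓ n F) (n C (k ∸ ℓ))) L

{-# OPTIONS --safe #-}
module Submission where

-- Colour vertices by finite trees with nodes labelled by numbers, and let e be an edge when
-- some y ∈ e has as its list of children the truncated colours of e - y, under
-- a root label that occurs in none of those colours.  For given depth and k
-- there are finitely many colours, so using each equally often gives every
-- (k-1)-set linear codegree, hence every ℓ-set degree of order n^(k-ℓ).
--
-- A copy of F in this k-graph makes F layered, provided the depth is at
-- least 2 |V(F)|².  As d grows, the partition of V(F) by the colours truncated at
-- depth d is refined, and the sets of root labels of V(F) visible in them grow,
-- so for some d neither changes from d to d + 1.  Label x by its colour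
-- truncated at d: this determines the truncation at d + 1, thus the labels
-- below x in any edge with top x.  The number of visible root labels strictly
-- increases from the rest of an edge to its top, so ordering the labels by it
-- first makes the top the unique maximum.

open import Defs
open import Algebra.Properties.CommutativeSemigroup using (x∙yz≈y∙xz)
open import Data.Fin using (Fin; toℕ; combine; fromℕ<; remQuot) renaming (zero to fzero; suc to fsuc)
import Data.Fin.Properties as Finₚ
open import Data.Fin.Subset using (Subset; inside; outside; _∈_; _∉_; _-_; _─_; _∪_; ∁; ⁅_⁆; _⊆_; ∣_∣; ⊥)
import Data.Fin.Subset.Properties as Subsetₚ
import Data.Integer as ℤ
import Data.Integer.Properties as ℤₚ
open import Data.List
  using (List; []; _∷_; _++_; map; filter; length; lookup; tabulate; upTo; allFin; concatMap;
         cartesianProduct; cartesianProductWith)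
open import Data.List.Extrema.Nat using (max≤v⁺; v≤max⁺; argmin-sel)
open import Data.List.Membership.Propositional using (find; lose) renaming (_∈_ to _∈ₗ_; _∉_ to _∉ₗ_)
import Data.List.Membership.DecPropositional as DecMem
import Data.List.Membership.Propositional.Properties as Memₚ
open import Data.List.Membership.Propositional.Properties.WithK using (unique∧set⇒bag)
import Data.List.Properties as Listₚ
open import Data.List.Relation.Binary.BagAndSetEquality using (∼bag⇒↭)
open import Data.List.Relation.Binary.Permutation.Propositional
  using (_↭_; prep; ↭-trans; ↭-sym; ↭-reflexive; module PermutationReasoning)
import Data.List.Relation.Binary.Permutation.Propositional.Properties as Permₚ
import Data.List.Relation.Binary.Sublist.Propositional as Sub
import Data.List.Relation.Binary.Sublist.Propositional.Properties as Subₚ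
open import Data.List.Relation.Binary.Subset.Propositional using () renaming (_⊆_ to _⊆ₗ_)
open import Data.List.Relation.Unary.All as All using (All; []; _∷_)
import Data.List.Relation.Unary.All.Properties as Allₚ
open import Data.List.Relation.Unary.AllPairs using ([]; _∷_)
open import Data.List.Relation.Unary.Any as Any using (here; there)
import Data.List.Relation.Unary.Any.Properties as Anyₚ
open import Data.List.Relation.Unary.Unique.Propositional using (Unique)
import Data.List.Relation.Unary.Unique.Propositional.Properties as Uniqueₚ
open import Data.Nat using (ℕ; zero; suc; _≤_; _<_; _∸_; _+_; _*_; _^_; z≤n; s≤s)
open import Data.Nat.Combinatorics
  using (_C_; nC1≡n; nCn≡1; nCk≡nC[n∸k]; nCk+nC[k+1]≡[n+1]C[k+1]; k>n⇒nCk≡0)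
open import Data.Nat.ListAction using (sum)
import Data.Nat.Properties as ℕₚ
open import Data.Product using (∃-syntax; _×_; _,_; proj₁; proj₂; uncurry)
open import Data.Rational as ℚ using (ℚ; 0ℚ)
import Data.Rational.Properties as ℚₚ
import Data.Rational.Unnormalised as ℚᵘ
import Data.Rational.Unnormalised.Properties as ℚᵘₚ
open import Data.Sum using (_⊎_; inj₁; inj₂)
open import Data.Vec using ([]; _∷_; here; there)
import Data.Vec.Properties as Vecₚ
open import Function using (_∘_; id; mk⇔)
open import Relation.Binary.Definitions using (DecidableEquality)
open import Relation.Binary.PropositionalEquality
  using (_≡_; refl; sym; trans; cong; cong₂; subst; subst₂; module ≡-Reasoning)
open import Relation.Nullary using (¬_; Dec; does; yes; no; ¬?; contradiction)
open import Relation.Nullary.Decidable using (map′; _×-dec_; decidable-stable; dec-true)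
open import Relation.Unary using (Decidable)

open DecMem ℕₚ._≟_ using () renaming (_∈?_ to _∈ₗ?_)

-- Trees

data Tree : Set where
  node : ℕ → List Tree → Tree

label : Tree → ℕ
label (node a _) = a

children : Tree → List Tree
children (node _ ts) = ts

trunc : ℕ → Tree → Tree
trunc zero    (node a _)  = node a []
trunc (suc d) (node a ts) = node a (map (trunc d) ts)

labelsTo : ℕ → Tree → List ℕ
labelsTo zero    (node a _)  = a ∷ []
labelsTo (suc d) (node a ts) = a ∷ concatMap (labelsTo d) ts

mutual
  infix 4 _≟ᵀ_ _≟ᶠ_
  _≟ᵀ_ : DecidableEquality Tree
  node a ts ≟ᵀ node b us =
    map′ (uncurry (cong₂ node)) (λ { refl → refl , refl }) (a ℕₚ.≟ b ×-dec ts ≟ᶠ us)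

  _≟ᶠ_ : DecidableEquality (List Tree)
  []     ≟ᶠ []     = yes refl
  []     ≟ᶠ _ ∷ _  = no λ ()
  _ ∷ _  ≟ᶠ []     = no λ ()
  t ∷ ts ≟ᶠ u ∷ us =
    map′ (uncurry (cong₂ _∷_)) (λ { refl → refl , refl }) (t ≟ᵀ u ×-dec ts ≟ᶠ us)

trunc-trunc : ∀ {d e} → d ≤ e → ∀ t → trunc d (trunc e t) ≡ trunc d t
trunc-trunc {e = zero}  z≤n       (node a ts) = refl
trunc-trunc {e = suc _} z≤n       (node a ts) = refl
trunc-trunc             (s≤s d≤e) (node a ts) = cong (node a) (begin
  map (trunc _) (map (trunc _) ts) ≡⟨ Listₚ.map-∘ ts ⟨
  map (trunc _ ∘ trunc _) ts       ≡⟨ Listₚ.map-cong (trunc-trunc d≤e) ts ⟩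
  map (trunc _) ts                 ∎)
  where open ≡-Reasoning

-- A truncation at depth at least `d` still shows every label down to depth `d`. Hence heights can
-- be computed from truncated colours alone, while freshness is stated for whole ones.
labelsTo-trunc : ∀ {d e} → d ≤ e → ∀ t → labelsTo d (trunc e t) ≡ labelsTo d t
labelsTo-trunc {e = zero}  z≤n       (node a ts) = refl
labelsTo-trunc {e = suc _} z≤n       (node a ts) = refl
labelsTo-trunc             (s≤s d≤e) (node a ts) = cong (a ∷_) (begin
  concatMap (labelsTo _) (map (trunc _) ts) ≡⟨ Listₚ.concatMap-map (labelsTo _) (trunc _) ts ⟩
  concatMap (labelsTo _ ∘ trunc _) ts       ≡⟨ Listₚ.concatMap-cong (labelsTo-trunc d≤e) ts ⟩
  concatMap (labelsTo _) ts                 ∎)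
  where open ≡-Reasoning

label∈labelsTo : ∀ d t → label t ∈ₗ labelsTo d t
label∈labelsTo zero    (node a ts) = here refl
label∈labelsTo (suc d) (node a ts) = here refl

labelsTo-child : ∀ d {t u} → u ∈ₗ children t → labelsTo d u ⊆ₗ labelsTo (suc d) t
labelsTo-child d {node a ts} u∈ts l∈ = there (Memₚ.∈-concatMap⁺ (labelsTo d) (lose u∈ts l∈))

labelsTo-mono : ∀ {d e} → d ≤ e → ∀ t → labelsTo d t ⊆ₗ labelsTo e t
labelsTo-mono {e = e} z≤n t@(node _ _) (here refl) = label∈labelsTo e t
labelsTo-mono (s≤s d≤e) (node a ts) (here refl) = here refl
labelsTo-mono (s≤s d≤e) t@(node a ts) (there l∈) =
  let u , u∈ts , l∈u = find (Memₚ.∈-concatMap⁻ (labelsTo _) {ts} l∈)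
  in labelsTo-child _ {t} u∈ts (labelsTo-mono d≤e u l∈u)

-- Stabilisation of growing predicates, and numbering of values

module _ {A : Set} {P Q : A → Set} (P? : Decidable P) (Q? : Decidable Q) where

  length-filter-mono : ∀ {xs} → (∀ {x} → x ∈ₗ xs → P x → Q x) →
                       length (filter P? xs) ≤ length (filter Q? xs)
  length-filter-mono {[]}     P⇒Q = z≤n
  length-filter-mono {x ∷ xs} P⇒Q with P? x | Q? x | length-filter-mono {xs} (P⇒Q ∘ there)
  ... | yes p | yes q | ih = s≤s ih
  ... | yes p | no ¬q | ih = contradiction (P⇒Q (here refl) p) ¬q
  ... | no ¬p | yes q | ih = ℕₚ.m≤n⇒m≤1+n ih
  ... | no ¬p | no ¬q | ih = ih

  length-filter-strict : ∀ {xs x} → (∀ {x} → x ∈ₗ xs → P x → Q x) →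
                         x ∈ₗ xs → Q x → ¬ P x →
                         length (filter P? xs) < length (filter Q? xs)
  length-filter-strict {x ∷ xs} P⇒Q (here refl) q ¬p
    rewrite Listₚ.filter-accept Q? {xs = xs} q | Listₚ.filter-reject P? {xs = xs} ¬p
    = s≤s (length-filter-mono (P⇒Q ∘ there))
  length-filter-strict {y ∷ xs} P⇒Q (there x∈) q ¬p
    with P? y | Q? y | length-filter-strict {xs} (P⇒Q ∘ there) x∈ q ¬p
  ... | yes p | yes _ | ih = s≤s ih
  ... | yes p | no ¬q | ih = contradiction (P⇒Q (here refl) p) ¬q
  ... | no _  | yes _ | ih = ℕₚ.m≤n⇒m≤1+n ih
  ... | no _  | no _  | ih = ih

module _ {A : Set} {P : ℕ → A → Set} (P? : ∀ d → Decidable (P d))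
         (P-suc : ∀ {d x} → P d x → P (suc d) x) where

  -- As long as stability fails, each step gains an entry of `xs` satisfying the predicate and loses
  -- none. After `length xs + 1` unstable steps there would be more such entries than entries.
  stabilises : ∀ xs → ∃[ d ] (d ≤ length xs × (∀ {x} → x ∈ₗ xs → P (suc d) x → P d x))
  stabilises xs with grows (suc (length xs))
    where
    Stable : ℕ → Set
    Stable d = ∀ {x} → x ∈ₗ xs → P (suc d) x → P d x

    grows : ∀ j → (∃[ d ] (d < j × Stable d)) ⊎ j ≤ length (filter (P? j) xs)
    grows zero = inj₂ z≤n
    grows (suc j) with grows j
    ... | inj₁ (d , d<j , st) = inj₁ (d , ℕₚ.m<n⇒m<1+n d<j , st)
    ... | inj₂ j≤ with Any.any? (λ x → P? (suc j) x ×-dec ¬? (P? j x)) xs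
    ...   | yes new = let x , x∈xs , p , ¬p = find new in
      inj₂ (ℕₚ.≤-<-trans j≤ (length-filter-strict (P? j) (P? (suc j)) (λ _ → P-suc) x∈xs p ¬p))
    ...   | no ¬new = inj₁ (j , ℕₚ.≤-refl , λ {x} x∈xs p →
      decidable-stable (P? j x) (λ ¬p → ¬new (lose x∈xs (p , ¬p))))
  ... | inj₁ (d , d< , st) = d , ℕₚ.≤-pred d< , st
  ... | inj₂ full = contradiction (ℕₚ.<-≤-trans full (Listₚ.length-filter (P? _) xs)) (ℕₚ.<-irrefl refl)

module _ {A : Set} (_≟_ : DecidableEquality A) {v} (g : Fin v → A) where

  -- A value of `g` is numbered by the preimage that the search returns, so only values in the range
  -- need distinct numbers. All other values share `fzero`.
  position : A → Fin (suc v)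
  position a with Finₚ.any? (λ x → g x ≟ a)
  ... | yes (x , _) = fsuc x
  ... | no _        = fzero

  position-injective : ∀ x y → position (g x) ≡ position (g y) → g x ≡ g y
  position-injective x y eq
    with Finₚ.any? (λ z → g z ≟ g x) | Finₚ.any? (λ z → g z ≟ g y)
  ... | no ¬p       | _           = contradiction (x , refl) ¬p
  ... | yes _       | no ¬p       = contradiction (y , refl) ¬p
  ... | yes (_ , p) | yes (_ , q) with refl ← eq = trans (sym p) q

-- Subsets and their lists of elements

∈-elements⁺ : ∀ {n} {e : Subset n} {x} → x ∈ e → x ∈ₗ elements e
∈-elements⁺ {e = e} {x} = Memₚ.∈-filter⁺ (Subsetₚ._∈? e) (Memₚ.∈-allFin x)

∈-elements⁻ : ∀ {n} {e : Subset n} {x} → x ∈ₗ elements e → x ∈ e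
∈-elements⁻ {n} {e} = proj₂ ∘ Memₚ.∈-filter⁻ (Subsetₚ._∈? e) {xs = allFin n}

elements-unique : ∀ {n} (e : Subset n) → Unique (elements e)
elements-unique e = Uniqueₚ.filter⁺ (Subsetₚ._∈? e) (Uniqueₚ.allFin⁺ _)

unique-↭ : ∀ {A : Set} {xs ys : List A} → Unique xs → Unique ys → xs ⊆ₗ ys → ys ⊆ₗ xs → xs ↭ ys
unique-↭ uxs uys xs⊆ys ys⊆xs = ∼bag⇒↭ (unique∧set⇒bag uxs uys (mk⇔ xs⊆ys ys⊆xs))

x∈p─q⇒x∉q : ∀ {n} {p q : Subset n} {x} → x ∈ p ─ q → x ∉ q
x∈p─q⇒x∉q {p = _ ∷ _} {outside ∷ _} here      ()
x∈p─q⇒x∉q {p = _ ∷ _} {outside ∷ _} (there x∈) (there x∈q) = x∈p─q⇒x∉q x∈ x∈q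
x∈p─q⇒x∉q {p = _ ∷ _} {inside ∷ _}  (there x∈) (there x∈q) = x∈p─q⇒x∉q x∈ x∈q

x∉p-x : ∀ {n} {p : Subset n} {x} → x ∉ p - x
x∉p-x x∈ = x∈p─q⇒x∉q x∈ (Subsetₚ.x∈⁅x⁆ _)

elements-remove : ∀ {n} {e : Subset n} {y} → y ∈ e → elements e ↭ y ∷ elements (e - y)
elements-remove {e = e} {y} y∈e = unique-↭ (elements-unique e)
  (All.tabulate (λ x∈ y≡x → x∉p-x (subst (_∈ e - y) (sym y≡x) (∈-elements⁻ x∈))) ∷
   elements-unique (e - y))
  (λ {x} x∈ → split x (∈-elements⁻ x∈))
  (λ { (here refl) → ∈-elements⁺ y∈e
     ; (there x∈)  → ∈-elements⁺ (Subsetₚ.p─q⊆p e _ (∈-elements⁻ x∈)) })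
  where
  split : ∀ x → x ∈ e → x ∈ₗ y ∷ elements (e - y)
  split x x∈e with x Finₚ.≟ y
  ... | yes refl = here refl
  ... | no x≢y   = there (∈-elements⁺ (Subsetₚ.x∈p∧x≢y⇒x∈p-y x∈e x≢y))

-- Graphs all of whose edges have an apex

-- Children are compared up to permutation because a copy of `F` in the painted graph need not
-- preserve the order of the vertices.
record IsApex {v} (D : ℕ) (c : Fin v → Tree) (e : Subset v) (y : Fin v) : Set where
  field
    apex∈     : y ∈ e
    children↭ : children (c y) ↭ map (trunc D ∘ c) (elements (e - y))
    fresh     : ∀ {x} → x ∈ e - y → label (c y) ∉ₗ labelsTo D (c x)

length-cartesianProductWith : ∀ {A B C : Set} (g : A → B → C) xs ys →
                              length (cartesianProductWith g xs ys) ≡ length xs * length ys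
length-cartesianProductWith g []       ys = refl
length-cartesianProductWith g (x ∷ xs) ys = trans (Listₚ.length-++ (map (g x) ys))
  (cong₂ _+_ (Listₚ.length-map (g x) ys) (length-cartesianProductWith g xs ys))

module _ {k v} (F : KGraph k v) {D} (c : Fin v → Tree) (v²+v²≤D : v * v + v * v ≤ D)
         (apex : ∀ {e} → e ∈ᴱ F → ∃[ y ] IsApex D c e y) where

  private
    view : ℕ → Fin v → Tree
    view d = trunc d ∘ c

    Separated Reaches : ℕ → Fin v × Fin v → Set
    Separated d (x , z) = ¬ (view d x ≡ view d z)
    Reaches   d (x , z) = label (c z) ∈ₗ labelsTo d (c x)

    -- Joining the two families lets one use of `stabilises` find a depth good for both. Only root
    -- labels of vertices of `F` are tracked, so there are `v * v` pairs of each kind, which is the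
    -- source of the bound on `D`.
    Refined : ℕ → (Fin v × Fin v) ⊎ (Fin v × Fin v) → Set
    Refined d (inj₁ p) = Separated d p
    Refined d (inj₂ p) = Reaches d p

    refined? : ∀ d → Decidable (Refined d)
    refined? d (inj₁ (x , z)) = ¬? (view d x ≟ᵀ view d z)
    refined? d (inj₂ (x , z)) = label (c z) ∈ₗ? labelsTo d (c x)

    view-suc : ∀ {d x z} → view (suc d) x ≡ view (suc d) z → view d x ≡ view d z
    view-suc {d} {x} {z} eq = begin
      view d x                   ≡⟨ trunc-trunc (ℕₚ.n≤1+n d) (c x) ⟨
      trunc d (view (suc d) x)   ≡⟨ cong (trunc d) eq ⟩
      trunc d (view (suc d) z)   ≡⟨ trunc-trunc (ℕₚ.n≤1+n d) (c z) ⟩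
      view d z                   ∎
      where open ≡-Reasoning

    refined-suc : ∀ {d p} → Refined d p → Refined (suc d) p
    refined-suc {p = inj₁ _}       = _∘ view-suc
    refined-suc {p = inj₂ (x , _)} = labelsTo-mono (ℕₚ.n≤1+n _) (c x)

    pairs : List (Fin v × Fin v)
    pairs = cartesianProduct (allFin v) (allFin v)

    ∈-pairs : ∀ x z → (x , z) ∈ₗ pairs
    ∈-pairs x z = Memₚ.∈-cartesianProduct⁺ (Memₚ.∈-allFin x) (Memₚ.∈-allFin z)

    length-pairs : length pairs ≡ v * v
    length-pairs = trans (length-cartesianProductWith _,_ (allFin v) (allFin v))
      (cong₂ _*_ (Listₚ.length-tabulate {n = v} id) (Listₚ.length-tabulate {n = v} id))

    both : List ((Fin v × Fin v) ⊎ (Fin v × Fin v))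
    both = map inj₁ pairs ++ map inj₂ pairs

    stable : ∃[ d ] (d ≤ length both × (∀ {p} → p ∈ₗ both → Refined (suc d) p → Refined d p))
    stable = stabilises {P = Refined} refined? (λ {d} {p} → refined-suc {d} {p}) both

    d : ℕ
    d = proj₁ stable

    d≤D : d ≤ D
    d≤D = ℕₚ.≤-trans (proj₁ (proj₂ stable)) (ℕₚ.≤-trans (ℕₚ.≤-reflexive eq) v²+v²≤D)
      where
      eq : length both ≡ v * v + v * v
      eq = trans (Listₚ.length-++ (map inj₁ pairs))
        (cong₂ _+_ (trans (Listₚ.length-map inj₁ pairs) length-pairs)
                   (trans (Listₚ.length-map inj₂ pairs) length-pairs))

    view-stable : ∀ {x z} → view d x ≡ view d z → view (suc d) x ≡ view (suc d) z
    view-stable {x} {z} eq = decidable-stable (view (suc d) x ≟ᵀ view (suc d) z) λ neq →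
      proj₂ (proj₂ stable) (Memₚ.∈-++⁺ˡ (Memₚ.∈-map⁺ inj₁ (∈-pairs x z))) neq eq

    reach-stable : ∀ {x z} → Reaches (suc d) (x , z) → Reaches d (x , z)
    reach-stable {x} {z} =
      proj₂ (proj₂ stable) (Memₚ.∈-++⁺ʳ (map inj₁ pairs) (Memₚ.∈-map⁺ inj₂ (∈-pairs x z)))

    reached? : ∀ t → Decidable (λ z → label (c z) ∈ₗ labelsTo d t)
    reached? t z = label (c z) ∈ₗ? labelsTo d t

    height : Tree → Fin (suc v)
    height t = fromℕ< {length (filter (reached? t) (allFin v))} (s≤s (ℕₚ.≤-trans
      (Listₚ.length-filter (reached? t) (allFin v)) (ℕₚ.≤-reflexive (Listₚ.length-tabulate {n = v} id))))

    -- `combine` orders pairs lexicographically: the height decides first, and the position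
    -- separates different views of equal height.
    encode : Tree → ℕ
    encode t = toℕ (combine (height t) (position _≟ᵀ_ (view d) t))

    f : Fin v → ℕ
    f = encode ∘ view d

    f-injective : ∀ {x z} → f x ≡ f z → view d x ≡ view d z
    f-injective {x} {z} eq = position-injective _≟ᵀ_ (view d) x z
      (Finₚ.combine-injectiveʳ (height (view d x)) _ (height (view d z)) _ (Finₚ.toℕ-injective eq))

    -- The children of an apex are colours cut at `D`. Since `d` is at most `D`, cutting them again
    -- at `d` gives the views of the remaining vertices exactly.
    children-view : ∀ {e y} → IsApex D c e y →
                    children (view (suc d) y) ↭ map (view d) (elements (e - y))
    children-view {e} {y} ap with c y | IsApex.children↭ ap
    ... | node a ts | ts↭ = ↭-trans (Permₚ.map⁺ (trunc d) ts↭) (↭-reflexive (begin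
      map (trunc d) (map (trunc D ∘ c) (elements (e - y))) ≡⟨ Listₚ.map-∘ (elements (e - y)) ⟨
      map (trunc d ∘ trunc D ∘ c) (elements (e - y))       ≡⟨ Listₚ.map-cong (trunc-trunc d≤D ∘ c) (elements (e - y)) ⟩
      map (view d) (elements (e - y))                      ∎))
      where open ≡-Reasoning

    -- The height strictly increases from `x` to the apex: every root label visible from `x` is
    -- visible from `y`, and the root label of `y` itself is new because it is fresh.
    f-apex : ∀ {e y x} → IsApex D c e y → x ∈ e - y → f x < f y
    f-apex {e} {y} {x} ap x∈ = Finₚ.combine-monoˡ-< {i = height (view d x)} {height (view d y)} _ _
      (subst₂ _<_ (sym (Finₚ.toℕ-fromℕ< _)) (sym (Finₚ.toℕ-fromℕ< _))
        (length-filter-strict (reached? (view d x)) (reached? (view d y)) x⇒y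
          (Memₚ.∈-allFin y) (label∈ y) ¬x))
      where
      label∈ : ∀ z → label (c z) ∈ₗ labelsTo d (view d z)
      label∈ z = subst (label (c z) ∈ₗ_) (sym (labelsTo-trunc ℕₚ.≤-refl (c z))) (label∈labelsTo d (c z))

      ¬x : label (c y) ∉ₗ labelsTo d (view d x)
      ¬x l∈ = IsApex.fresh ap x∈
        (labelsTo-mono d≤D (c x) (subst (label (c y) ∈ₗ_) (labelsTo-trunc ℕₚ.≤-refl (c x)) l∈))

      child : view d x ∈ₗ children (view (suc d) y)
      child = Permₚ.∈-resp-↭ (↭-sym (children-view ap)) (Memₚ.∈-map⁺ (view d) (∈-elements⁺ x∈))

      -- A label within depth `d` of the child lies within depth `d + 1` of `y`, and stability of
      -- `d` brings it back within depth `d`.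
      x⇒y : ∀ {z} → z ∈ₗ allFin v → label (c z) ∈ₗ labelsTo d (view d x) → label (c z) ∈ₗ labelsTo d (view d y)
      x⇒y _ l∈ = subst (_ ∈ₗ_) (sym (labelsTo-trunc ℕₚ.≤-refl (c y)))
        (reach-stable (subst (_ ∈ₗ_) (labelsTo-trunc ℕₚ.≤-refl (c y)) (labelsTo-child d child l∈)))

    maxLabel-apex : ∀ {e y} → IsApex D c e y → maxLabel f e ≡ f y
    maxLabel-apex {e} {y} ap = ℕₚ.≤-antisym
      (max≤v⁺ z≤n (Allₚ.map⁺ (All.tabulate λ {x} x∈ → below x (∈-elements⁻ x∈))))
      (v≤max⁺ 0 _ (inj₂ (lose (Memₚ.∈-map⁺ f (∈-elements⁺ (IsApex.apex∈ ap))) ℕₚ.≤-refl)))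
      where
      below : ∀ x → x ∈ e → f x ≤ f y
      below x x∈e with x Finₚ.≟ y
      ... | yes refl = ℕₚ.≤-refl
      ... | no x≢y   = ℕₚ.<⇒≤ (f-apex ap (Subsetₚ.x∈p∧x≢y⇒x∈p-y x∈e x≢y))

    -- This exhibits the multiset of labels as a function of `f y` and the view of `y` at depth
    -- `d + 1`, with no further reference to the edge.
    labels-apex : ∀ {e y} → IsApex D c e y →
                  labels f e ↭ f y ∷ map encode (children (view (suc d) y))
    labels-apex {e} {y} ap = begin
      map f (elements e)                                   ↭⟨ Permₚ.map⁺ f (elements-remove (IsApex.apex∈ ap)) ⟩
      f y ∷ map f (elements (e - y))                       ≡⟨ cong (f y ∷_) (Listₚ.map-∘ (elements (e - y))) ⟩
      f y ∷ map encode (map (view d) (elements (e - y)))   ↭⟨ prep (f y) (Permₚ.map⁺ encode (children-view ap)) ⟨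
      f y ∷ map encode (children (view (suc d) y))         ∎
      where open PermutationReasoning

  layered-of-apices : Layered F
  layered-of-apices = f , record
    { uniqueMax  = λ {e} e∈F → let y , ap = apex e∈F in
        y , (IsApex.apex∈ ap , sym (maxLabel-apex ap)) ,
        -- Any other vertex of the edge has a strictly smaller label than the apex, so it cannot
        -- attain the maximum.
        λ {x} (x∈e , fx≡) → decidable-stable (y Finₚ.≟ x) λ y≢x →
          ℕₚ.<-irrefl (trans fx≡ (maxLabel-apex ap))
            (f-apex ap (Subsetₚ.x∈p∧x≢y⇒x∈p-y x∈e (y≢x ∘ sym)))
    ; sameLabels = λ {e} {e′} e∈F e′∈F max≡ →
        let y , ap = apex e∈F; y′ , ap′ = apex e′∈F
            -- Equal maxima mean equal labels of the two apices, hence equal views at `d`, hence by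
            -- stability equal views at `d + 1`, which determine the rest of both multisets.
            fy≡fy′ = trans (sym (maxLabel-apex ap)) (trans max≡ (maxLabel-apex ap′))
        in ↭-trans (labels-apex ap) (↭-trans
             (↭-reflexive (cong₂ (λ a t → a ∷ map encode (children t)) fy≡fy′ (view-stable (f-injective fy≡fy′))))
             (↭-sym (labels-apex ap′)))
    }

-- The palette of colours

unique⊆⇒length≤ : ∀ {A : Set} {xs ys : List A} → Unique xs → xs ⊆ₗ ys → length xs ≤ length ys
unique⊆⇒length≤ {xs = []}         uxs         xs⊆ys = z≤n
unique⊆⇒length≤ {xs = x ∷ xs} {ys} (x∉ ∷ uxs) xs⊆ys
  with as , bs , refl ← Memₚ.∈-∃++ (xs⊆ys (here refl)) = begin
  suc (length xs)              ≤⟨ s≤s (unique⊆⇒length≤ uxs avoid) ⟩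
  suc (length (as ++ bs))      ≡⟨ cong suc (Listₚ.length-++ as) ⟩
  suc (length as + length bs)  ≡⟨ ℕₚ.+-suc (length as) (length bs) ⟨
  length as + suc (length bs)  ≡⟨ Listₚ.length-++ as ⟨
  length (as ++ x ∷ bs)        ∎
  where
  open ℕₚ.≤-Reasoning
  avoid : xs ⊆ₗ as ++ bs
  avoid {z} z∈ with Memₚ.∈-++⁻ as (xs⊆ys (there z∈))
  ... | inj₁ z∈as         = Memₚ.∈-++⁺ˡ z∈as
  ... | inj₂ (here refl)  = contradiction refl (All.lookup x∉ z∈)
  ... | inj₂ (there z∈bs) = Memₚ.∈-++⁺ʳ as z∈bs

-- The `length xs + 1` numbers from 0 to `length xs` cannot all occur in `xs`. The bound on `r` is
-- what allows a finite palette.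
fresh-number : ∀ (xs : List ℕ) → ∃[ r ] (r ≤ length xs × r ∉ₗ xs)
fresh-number xs with Any.any? (λ r → ¬? (r ∈ₗ? xs)) (upTo (suc (length xs)))
... | yes found = let r , r∈ , r∉ = find found in r , ℕₚ.≤-pred (Memₚ.∈-upTo⁻ r∈) , r∉
... | no none = contradiction
  (subst (_≤ length xs) (Listₚ.length-upTo (suc (length xs)))
    (unique⊆⇒length≤ (Uniqueₚ.upTo⁺ (suc (length xs)))
      λ {r} r∈ → decidable-stable (r ∈ₗ? xs) λ r∉ → none (lose r∈ r∉)))
  (ℕₚ.<-irrefl refl)

words : ∀ {A : Set} → ℕ → List A → List (List A)
words zero    xs = [] ∷ []
words (suc n) xs = cartesianProductWith _∷_ xs (words n xs)

∈-words⁺ : ∀ {A : Set} {xs : List A} {n} ys → length ys ≡ n → All (_∈ₗ xs) ys → ys ∈ₗ words n xs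
∈-words⁺ []       refl []         = here refl
∈-words⁺ (y ∷ ys) refl (y∈ ∷ ys∈) = Memₚ.∈-cartesianProductWith⁺ _∷_ y∈ (∈-words⁺ ys refl ys∈)

∈-words⁻ : ∀ {A : Set} {xs : List A} n {ys} → ys ∈ₗ words n xs → length ys ≡ n × All (_∈ₗ xs) ys
∈-words⁻ zero (here refl) = refl , []
∈-words⁻ {xs = xs} (suc n) ys∈
  with _ , _ , z∈ , zs∈ , refl ← Memₚ.∈-cartesianProductWith⁻ _∷_ xs (words n xs) ys∈ =
  let eq , all = ∈-words⁻ n zs∈ in cong suc eq , z∈ ∷ all

length-concatMap-≤ : ∀ {A B : Set} (g : A → List B) {b xs} → All (λ x → length (g x) ≤ b) xs →
                     length (concatMap g xs) ≤ length xs * b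
length-concatMap-≤ g []                  = z≤n
length-concatMap-≤ g {b} {x ∷ xs} (p ∷ ps) = begin
  length (g x ++ concatMap g xs)         ≡⟨ Listₚ.length-++ (g x) ⟩
  length (g x) + length (concatMap g xs) ≤⟨ ℕₚ.+-mono-≤ p (length-concatMap-≤ g ps) ⟩
  b + length xs * b                      ∎
  where open ℕₚ.≤-Reasoning

module _ (κ : ℕ) where

  -- The number of nodes of the complete `κ`-ary tree of depth `d`, used to bound how many labels a
  -- colour can show.
  treeSize : ℕ → ℕ
  treeSize zero    = 1
  treeSize (suc d) = suc (κ * treeSize d)

  module _ (M : ℕ) where

    -- The extra tree node 0 [] makes the list manifestly nonempty.
    trees : ℕ → List Tree
    trees zero    = map (λ a → node a []) (upTo (suc M))
    trees (suc d) = node 0 [] ∷ cartesianProductWith node (upTo (suc M)) (words κ (trees d))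

    ∈-trees⁻ : ∀ d {a ts} → node a ts ∈ₗ trees (suc d) →
               node a ts ≡ node 0 [] ⊎ (a ≤ M × length ts ≡ κ × All (_∈ₗ trees d) ts)
    ∈-trees⁻ d (here eq) = inj₁ eq
    ∈-trees⁻ d (there t∈)
      with _ , _ , a∈ , ts∈ , refl ← Memₚ.∈-cartesianProductWith⁻ node (upTo (suc M)) (words κ (trees d)) t∈ =
      inj₂ (ℕₚ.≤-pred (Memₚ.∈-upTo⁻ a∈) , ∈-words⁻ κ ts∈)

    ∈-trees⁺ : ∀ d {a ts} → a ≤ M → length ts ≡ κ → All (_∈ₗ trees d) ts → node a ts ∈ₗ trees (suc d)
    ∈-trees⁺ d {ts = ts} a≤M len ts∈ =
      there (Memₚ.∈-cartesianProductWith⁺ node (Memₚ.∈-upTo⁺ (s≤s a≤M)) (∈-words⁺ ts len ts∈))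

    -- This makes truncated colours available as children of a further colour. The extra tree is its
    -- own truncation; at depth 0 it is the single node labelled 0.
    trunc-∈-trees : ∀ d {t} → t ∈ₗ trees (suc d) → trunc d t ∈ₗ trees d
    trunc-∈-trees d {node a ts} t∈ with d | ∈-trees⁻ d t∈
    ... | zero  | inj₁ refl                = here refl
    ... | suc _ | inj₁ refl                = here refl
    ... | zero  | inj₂ (a≤M , _)           = Memₚ.∈-map⁺ (λ a → node a []) (Memₚ.∈-upTo⁺ (s≤s a≤M))
    ... | suc d | inj₂ (a≤M , len , ts∈) =
      ∈-trees⁺ d a≤M (trans (Listₚ.length-map (trunc d) ts) len)
        (Allₚ.map⁺ (All.map (trunc-∈-trees d) ts∈))

    length-labelsTo : ∀ d {t} → t ∈ₗ trees d → length (labelsTo d t) ≤ treeSize d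
    length-labelsTo zero    {node a ts} t∈ = ℕₚ.≤-refl
    length-labelsTo (suc d) {node a ts} t∈ with ∈-trees⁻ d t∈
    ... | inj₁ refl             = s≤s z≤n
    ... | inj₂ (_ , refl , ts∈) = s≤s (length-concatMap-≤ (labelsTo d) (All.map (length-labelsTo d) ts∈))

  -- `dominate` is the extension property behind linear codegrees: any `κ` colours, repetitions
  -- allowed, are completed by a colour that can serve as apex over them. Writing the size as a
  -- successor records that there is at least one colour.
  record Palette (D : ℕ) : Set where
    field
      size-1   : ℕ
      colour   : Fin (suc size-1) → Tree
      dominate : ∀ xs → length xs ≡ κ →
                 ∃[ i ] (children (colour i) ≡ map (trunc D ∘ colour) xs ×
                         All (λ x → label (colour i) ∉ₗ labelsTo D (colour x)) xs)

  palette : ∀ D → Palette D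
  palette D = record { size-1 = _ ; colour = colour ; dominate = dominate }
    where
    -- The `κ` children show at most `κ * treeSize D` labels altogether, so some number up to this
    -- bound is fresh.
    M : ℕ
    M = κ * treeSize D

    colour : Fin (length (trees M (suc D))) → Tree
    colour = lookup (trees M (suc D))

    dominate : ∀ xs → length xs ≡ κ →
               ∃[ i ] (children (colour i) ≡ map (trunc D ∘ colour) xs ×
                       All (λ x → label (colour i) ∉ₗ labelsTo D (colour x)) xs)
    dominate xs len with fresh-number (concatMap (labelsTo D ∘ trunc D ∘ colour) xs)
    ... | r , r≤ , r∉ = Any.index t∈ , cong children (sym col≡) ,
      All.tabulate λ {x} x∈ r∈ → r∉ (Memₚ.∈-concatMap⁺ (labelsTo D ∘ trunc D ∘ colour)
        (lose x∈ (subst₂ _∈ₗ_ (cong label (sym col≡)) (sym (labelsTo-trunc ℕₚ.≤-refl (colour x))) r∈)))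
      where
      ts : List Tree
      ts = map (trunc D ∘ colour) xs

      bound : concatMap (labelsTo D ∘ trunc D ∘ colour) xs ≡ concatMap (labelsTo D) ts
      bound = sym (Listₚ.concatMap-map (labelsTo D) (trunc D ∘ colour) xs)

      ts∈ : All (_∈ₗ trees M D) ts
      ts∈ = Allₚ.map⁺ (All.tabulate λ {x} _ → trunc-∈-trees M D (Memₚ.∈-lookup x))

      len-ts : length ts ≡ κ
      len-ts = trans (Listₚ.length-map _ xs) len

      r≤M : r ≤ M
      r≤M = begin
        r                                                      ≤⟨ r≤ ⟩
        length (concatMap (labelsTo D ∘ trunc D ∘ colour) xs)  ≡⟨ cong length bound ⟩
        length (concatMap (labelsTo D) ts)                     ≤⟨ length-concatMap-≤ (labelsTo D)
                                                                    (All.map (length-labelsTo M D) ts∈) ⟩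
        length ts * treeSize D                                 ≡⟨ cong (_* treeSize D) len-ts ⟩
        M                                                      ∎
        where open ℕₚ.≤-Reasoning

      t∈ : node r ts ∈ₗ trees M (suc D)
      t∈ = ∈-trees⁺ M D r≤M len-ts ts∈

      col≡ : node r ts ≡ colour (Any.index t∈)
      col≡ = Anyₚ.lookup-index t∈

-- Degrees and binomial coefficients

∣p∪⁅x⁆∣ : ∀ {n} {p : Subset n} {x} → x ∉ p → ∣ p ∪ ⁅ x ⁆ ∣ ≡ suc ∣ p ∣
∣p∪⁅x⁆∣ {p = inside  ∷ p} {fzero}  x∉p = contradiction here x∉p
∣p∪⁅x⁆∣ {p = outside ∷ p} {fzero}  x∉p = cong (suc ∘ ∣_∣) (Subsetₚ.∪-identityʳ p)
∣p∪⁅x⁆∣ {p = inside  ∷ p} {fsuc x} x∉p = cong suc (∣p∪⁅x⁆∣ (x∉p ∘ there))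
∣p∪⁅x⁆∣ {p = outside ∷ p} {fsuc x} x∉p = ∣p∪⁅x⁆∣ (x∉p ∘ there)

x∈p∪⁅x⁆ : ∀ {n} (p : Subset n) x → x ∈ p ∪ ⁅ x ⁆
x∈p∪⁅x⁆ p x = Subsetₚ.q⊆p∪q p ⁅ x ⁆ (Subsetₚ.x∈⁅x⁆ x)

[p∪⁅x⁆]-x≡p : ∀ {n} {p : Subset n} {x} → x ∉ p → (p ∪ ⁅ x ⁆) - x ≡ p
[p∪⁅x⁆]-x≡p {p = p} {x} x∉p = Subsetₚ.⊆-antisym back
  (λ {z} z∈p → Subsetₚ.x∈p∧x≢y⇒x∈p-y (Subsetₚ.p⊆p∪q ⁅ x ⁆ z∈p) λ { refl → x∉p z∈p })
  where
  back : (p ∪ ⁅ x ⁆) - x ⊆ p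
  back {z} z∈ with Subsetₚ.x∈p∪q⁻ p ⁅ x ⁆ (Subsetₚ.p─q⊆p (p ∪ ⁅ x ⁆) ⁅ x ⁆ z∈)
  ... | inj₁ z∈p = z∈p
  ... | inj₂ z∈x = contradiction z∈x (x∈p─q⇒x∉q z∈)

length-filter-tabulate : ∀ {A : Set} {P : A → Set} (P? : Decidable P) {n} (g : Fin n → A) (p : Subset n) →
                         (∀ {x} → P (g x) → x ∈ p) → (∀ {x} → x ∈ p → P (g x)) →
                         length (filter P? (tabulate g)) ≡ ∣ p ∣
length-filter-tabulate P? g []      to from = refl
length-filter-tabulate P? g (inside ∷ p) to from
  with P? (g fzero) | length-filter-tabulate P? (g ∘ fsuc) p (Subsetₚ.drop-there ∘ to) (from ∘ there)
... | yes _ | ih = cong suc ih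
... | no ¬q | ih = contradiction (from here) ¬q
length-filter-tabulate P? g (outside ∷ p) to from
  with P? (g fzero) | length-filter-tabulate P? (g ∘ fsuc) p (Subsetₚ.drop-there ∘ to) (from ∘ there)
... | yes q | ih = contradiction (to q) λ ()
... | no _  | ih = ih

length-elements : ∀ {n} (p : Subset n) → length (elements p) ≡ ∣ p ∣
length-elements p = length-filter-tabulate (Subsetₚ._∈? p) id p id id

∈-subsets : ∀ {n} (p : Subset n) → p ∈ₗ subsets n
∈-subsets []            = here refl
∈-subsets (inside  ∷ p) = Memₚ.∈-++⁺ˡ (Memₚ.∈-map⁺ (inside ∷_) (∈-subsets p))
∈-subsets {suc n} (outside ∷ p) = Memₚ.∈-++⁺ʳ (map (inside ∷_) (subsets n)) (Memₚ.∈-map⁺ (outside ∷_) (∈-subsets p))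

∈-subsetsOfSize⁺ : ∀ {m n} {p : Subset n} → ∣ p ∣ ≡ m → p ∈ₗ subsetsOfSize m n
∈-subsetsOfSize⁺ {m} {p = p} = Memₚ.∈-filter⁺ (λ s → ∣ s ∣ ℕₚ.≟ m) (∈-subsets p)

∈-subsetsOfSize⁻ : ∀ {m n} {p : Subset n} → p ∈ₗ subsetsOfSize m n → ∣ p ∣ ≡ m
∈-subsetsOfSize⁻ {m} {n} = proj₂ ∘ Memₚ.∈-filter⁻ (λ s → ∣ s ∣ ℕₚ.≟ m) {xs = subsets n}

module _ {A B : Set} {R : A → B → Set} (R? : ∀ a b → Dec (R a b)) where

  private
    row : List B → A → ℕ
    row bs a = length (filter (R? a) bs)

    column : List A → B → ℕ
    column as b = length (filter (λ a → R? a b) as)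

    sum-rows-∷ : ∀ as b bs → sum (map (row (b ∷ bs)) as) ≡ column as b + sum (map (row bs) as)
    sum-rows-∷ []       b bs = refl
    sum-rows-∷ (a ∷ as) b bs with R? a b | sum-rows-∷ as b bs
    ... | yes _ | ih = cong suc (trans (cong (row bs a +_) ih)
                                       (x∙yz≈y∙xz ℕₚ.+-commutativeSemigroup (row bs a) (column as b) (sum (map (row bs) as))))
    ... | no _  | ih = trans (cong (row bs a +_) ih)
                             (x∙yz≈y∙xz ℕₚ.+-commutativeSemigroup (row bs a) (column as b) (sum (map (row bs) as)))

  -- The related pairs are counted by columns instead of rows: a column outside `Q` is empty, and
  -- one inside contributes at most `q`.
  double-count-≤ : ∀ {Q : B → Set} (Q? : Decidable Q) {q} as bs →
                   (∀ {a b} → R a b → Q b) →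
                   All (λ b → Q b → column as b ≤ q) bs →
                   sum (map (row bs) as) ≤ q * length (filter Q? bs)
  double-count-≤ Q? as [] R⇒Q [] = ℕₚ.≤-trans (ℕₚ.≤-reflexive (zeros as)) z≤n
    where
    zeros : ∀ as → sum (map (row []) as) ≡ 0
    zeros []       = refl
    zeros (_ ∷ as) = zeros as
  double-count-≤ Q? {q} as (b ∷ bs) R⇒Q (col ∷ cols) with Q? b | double-count-≤ Q? as bs R⇒Q cols
  ... | yes Qb | ih = begin
    sum (map (row (b ∷ bs)) as)             ≡⟨ sum-rows-∷ as b bs ⟩
    column as b + sum (map (row bs) as)     ≤⟨ ℕₚ.+-mono-≤ (col Qb) ih ⟩
    q + q * length (filter Q? bs)           ≡⟨ ℕₚ.*-suc q _ ⟨
    q * suc (length (filter Q? bs))         ∎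
    where open ℕₚ.≤-Reasoning
  ... | no ¬Qb | ih = begin
    sum (map (row (b ∷ bs)) as)             ≡⟨ sum-rows-∷ as b bs ⟩
    column as b + sum (map (row bs) as)     ≡⟨ cong (λ xs → length xs + _) none ⟩
    sum (map (row bs) as)                   ≤⟨ ih ⟩
    q * length (filter Q? bs)               ∎
    where
    open ℕₚ.≤-Reasoning
    none : filter (λ a → R? a b) as ≡ []
    none = Listₚ.filter-none (λ a → R? a b) {as} (All.tabulate λ _ → ¬Qb ∘ R⇒Q)

length*≤sum : ∀ {A : Set} (h : A → ℕ) {p c} as → (∀ {a} → a ∈ₗ as → p ≤ c * h a) →
              length as * p ≤ c * sum (map h as)
length*≤sum h             []       bound = z≤n
length*≤sum h {p} {c} (a ∷ as) bound = begin
  p + length as * p              ≤⟨ ℕₚ.+-mono-≤ (bound (here refl)) (length*≤sum h {p} {c} as (bound ∘ there)) ⟩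
  c * h a + c * sum (map h as)   ≡⟨ ℕₚ.*-distribˡ-+ c (h a) _ ⟨
  c * (h a + sum (map h as))     ∎
  where open ℕₚ.≤-Reasoning

nC0≡1 : ∀ n → n C 0 ≡ 1
nC0≡1 n = trans (nCk≡nC[n∸k] {n = n} z≤n) (nCn≡1 n)

0<nCk : ∀ {n k} → k ≤ n → 0 < n C k
0<nCk {n} z≤n = ℕₚ.≤-reflexive (sym (nC0≡1 n))
0<nCk {suc n} {suc k} (s≤s k≤n) = ℕₚ.<-≤-trans (0<nCk k≤n)
  (ℕₚ.≤-trans (ℕₚ.m≤m+n (n C k) _) (ℕₚ.≤-reflexive (nCk+nC[k+1]≡[n+1]C[k+1] n k)))

-- The left side is exactly `n - k` times `n C k`. The weaker factor `n` permits an induction by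
-- Pascal's rule free of subtraction.
[k+1]*nC[k+1]≤n*nCk : ∀ n k → suc k * (n C suc k) ≤ n * (n C k)
[k+1]*nC[k+1]≤n*nCk zero    k    = ℕₚ.≤-reflexive (begin
  suc k * (0 C suc k) ≡⟨ cong (suc k *_) (k>n⇒nCk≡0 {0} {suc k} (s≤s z≤n)) ⟩
  suc k * 0           ≡⟨ ℕₚ.*-zeroʳ (suc k) ⟩
  0                   ∎)
  where open ≡-Reasoning
[k+1]*nC[k+1]≤n*nCk (suc n) zero = ℕₚ.≤-reflexive (begin
  1 * (suc n C 1)     ≡⟨ ℕₚ.*-identityˡ _ ⟩
  suc n C 1           ≡⟨ nC1≡n (suc n) ⟩
  suc n               ≡⟨ ℕₚ.*-identityʳ (suc n) ⟨
  suc n * 1           ≡⟨ cong (suc n *_) (nC0≡1 (suc n)) ⟨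
  suc n * (suc n C 0) ∎)
  where open ≡-Reasoning
[k+1]*nC[k+1]≤n*nCk (suc n) (suc k) = begin
  k₂ * (suc n C k₂)                           ≡⟨ cong (k₂ *_) (nCk+nC[k+1]≡[n+1]C[k+1] n k₁) ⟨
  k₂ * (n C k₁ + n C k₂)                      ≡⟨ ℕₚ.*-distribˡ-+ k₂ (n C k₁) _ ⟩
  n C k₁ + k₁ * (n C k₁) + k₂ * (n C k₂)      ≤⟨ ℕₚ.+-mono-≤ (ℕₚ.+-monoʳ-≤ (n C k₁) ([k+1]*nC[k+1]≤n*nCk n k))
                                                             ([k+1]*nC[k+1]≤n*nCk n k₁) ⟩
  n C k₁ + n * (n C k) + n * (n C k₁)         ≡⟨ ℕₚ.+-assoc (n C k₁) _ _ ⟩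
  n C k₁ + (n * (n C k) + n * (n C k₁))       ≡⟨ cong (n C k₁ +_) (ℕₚ.*-distribˡ-+ n (n C k) _) ⟨
  n C k₁ + n * (n C k + n C k₁)               ≡⟨ cong (λ z → n C k₁ + n * z) (nCk+nC[k+1]≡[n+1]C[k+1] n k) ⟩
  n C k₁ + n * (suc n C k₁)                   ≤⟨ ℕₚ.+-monoˡ-≤ _ (ℕₚ.m≤n+m (n C k₁) (n C k)) ⟩
  n C k + n C k₁ + n * (suc n C k₁)           ≡⟨ cong (_+ n * (suc n C k₁)) (nCk+nC[k+1]≡[n+1]C[k+1] n k) ⟩
  suc n C k₁ + n * (suc n C k₁)               ∎
  where
  open ℕₚ.≤-Reasoning
  k₁ = suc k
  k₂ = suc k₁

-- Images of edges, and pulling apices back along an injection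

module _ {v n} (φ : Fin v → Fin n) where

  ∈-image⁺ : ∀ {e x} → x ∈ e → φ x ∈ image φ e
  ∈-image⁺ {e} {x} x∈e = Vecₚ.lookup⇒[]= (φ x) (image φ e)
    (trans (Vecₚ.lookup∘tabulate (does ∘ hits? φ e) (φ x)) (dec-true (hits? φ e (φ x)) (x , x∈e , refl)))

  ∈-image⁻ : ∀ {e y} → y ∈ image φ e → ∃[ x ] (x ∈ e × φ x ≡ y)
  ∈-image⁻ {e} {y} y∈ with hits? φ e y | trans (sym (Vecₚ.lookup∘tabulate (does ∘ hits? φ e) y)) (Vecₚ.[]=⇒lookup y∈)
  ... | yes hit | _ = hit
  ... | no _    | ()

  elements-image-remove : (∀ {x z} → φ x ≡ φ z → x ≡ z) → ∀ e y →
                          elements (image φ e - φ y) ↭ map φ (elements (e - y))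
  elements-image-remove φ-inj e y = unique-↭ (elements-unique (image φ e - φ y))
    (Uniqueₚ.map⁺ φ-inj (elements-unique (e - y))) to from
    where
    to : elements (image φ e - φ y) ⊆ₗ map φ (elements (e - y))
    to z∈ with z∈′ ← ∈-elements⁻ z∈ with ∈-image⁻ (Subsetₚ.p─q⊆p (image φ e) _ z∈′)
    ... | x , x∈e , refl = Memₚ.∈-map⁺ φ (∈-elements⁺
      (Subsetₚ.x∈p∧x≢y⇒x∈p-y x∈e λ { refl → x∉p-x {p = image φ e} z∈′ }))

    from : map φ (elements (e - y)) ⊆ₗ elements (image φ e - φ y)
    from z∈ with x , x∈ , refl ← Memₚ.∈-map⁻ φ z∈ = ∈-elements⁺ (Subsetₚ.x∈p∧x≢y⇒x∈p-y
      (∈-image⁺ (Subsetₚ.p─q⊆p e _ x∈e-y))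
      λ φx≡φy → x∉p-x {p = e} (subst (_∈ e - y) (φ-inj φx≡φy) x∈e-y))
      where x∈e-y = ∈-elements⁻ x∈

-- IsApex with the children in the order of elements, which makes it decidable.
OrderedApex : ∀ {n} → ℕ → (Fin n → Tree) → Subset n → Fin n → Set
OrderedApex D c e y = y ∈ e × children (c y) ≡ map (trunc D ∘ c) (elements (e - y)) ×
                      All (λ x → label (c y) ∉ₗ labelsTo D (c x)) (elements (e - y))

orderedApex? : ∀ {n} D (c : Fin n → Tree) e → Decidable (OrderedApex D c e)
orderedApex? D c e y = y Subsetₚ.∈? e ×-dec children (c y) ≟ᶠ map (trunc D ∘ c) (elements (e - y)) ×-dec
                       All.all? (λ x → ¬? (label (c y) ∈ₗ? labelsTo D (c x))) (elements (e - y))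

module _ {v n D : ℕ} {c : Fin n → Tree} (φ : Fin v → Fin n)
         (φ-inj : ∀ {x z : Fin v} → φ x ≡ φ z → x ≡ z) where

  orderedApex⇒isApex : ∀ {e y} → OrderedApex D c (image φ e) (φ y) → IsApex D (c ∘ φ) e y
  orderedApex⇒isApex {e} {y} (y∈ , children≡ , fresh) = record
    { apex∈     = let x , x∈e , φx≡φy = ∈-image⁻ φ y∈ in subst (_∈ e) (φ-inj φx≡φy) x∈e
    ; children↭ = ↭-trans (↭-reflexive children≡) (↭-trans
        (Permₚ.map⁺ (trunc D ∘ c) (elements-image-remove φ φ-inj e y))
        (↭-reflexive (sym (Listₚ.map-∘ (elements (e - y))))))
    ; fresh     = λ x∈ → All.lookup fresh (∈-elements⁺ (Subsetₚ.x∈p∧x≢y⇒x∈p-y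
        (∈-image⁺ φ (Subsetₚ.p─q⊆p e _ x∈))
        λ φx≡φy → x∉p-x {p = e} (subst (_∈ e - y) (φ-inj φx≡φy) x∈)))
    }

-- The notion `degree` for bare edge lists, so that the painted edges can be studied before a
-- `KGraph` with these edges is chosen.
codegree : ∀ {n} → List (Subset n) → Subset n → ℕ
codegree es S = length (filter (S Subsetₚ.⊆?_) es)

-- Every edge containing S contains k ∸ ∣ S ∣ of the sets S ∪ ⁅ x ⁆.
extensions-≤ : ∀ {n k j} {es : List (Subset n)} → All (λ e → ∣ e ∣ ≡ k) es →
               ∀ S → ∣ S ∣ + j ≡ k →
               sum (map (λ x → codegree es (S ∪ ⁅ x ⁆)) (elements (∁ S))) ≤ j * codegree es S
extensions-≤ {k = k} {j} {es} uniform S ∣S∣+j≡k =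
  double-count-≤ R? (S Subsetₚ.⊆?_) (elements (∁ S)) es (λ S∪x⊆e x∈S → S∪x⊆e (Subsetₚ.p⊆p∪q _ x∈S))
    (All.map (λ {e} → bound {e}) uniform)
  where
  R? : ∀ x e → Dec (S ∪ ⁅ x ⁆ ⊆ e)
  R? x e = S ∪ ⁅ x ⁆ Subsetₚ.⊆? e

  bound : ∀ {e} → ∣ e ∣ ≡ k → S ⊆ e → length (filter (λ x → R? x e) (elements (∁ S))) ≤ j
  -- The counted vertices lie in `e` and outside `S`, and `S` leaves only `j` places in `e`.
  bound {e} ∣e∣≡k S⊆e = ℕₚ.+-cancelˡ-≤ ∣ S ∣ _ _ (begin
    ∣ S ∣ + length xs                 ≡⟨ cong (_+ length xs) (length-elements S) ⟨
    length (elements S) + length xs   ≡⟨ Listₚ.length-++ (elements S) ⟨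
    length (elements S ++ xs)         ≤⟨ unique⊆⇒length≤ unique ⊆e ⟩
    length (elements e)               ≡⟨ length-elements e ⟩
    ∣ e ∣                             ≡⟨ trans ∣e∣≡k (sym ∣S∣+j≡k) ⟩
    ∣ S ∣ + j                         ∎)
    where
    open ℕₚ.≤-Reasoning
    xs = filter (λ x → R? x e) (elements (∁ S))

    ∈-xs⁻ : ∀ {x} → x ∈ₗ xs → x ∈ₗ elements (∁ S) × S ∪ ⁅ x ⁆ ⊆ e
    ∈-xs⁻ = Memₚ.∈-filter⁻ (λ x → R? x e) {xs = elements (∁ S)}

    unique : Unique (elements S ++ xs)
    unique = Uniqueₚ.++⁺ (elements-unique S) (Uniqueₚ.filter⁺ (λ x → R? x e) (elements-unique (∁ S)))
      λ (x∈S , x∈xs) → Subsetₚ.x∈∁p⇒x∉p (∈-elements⁻ (proj₁ (∈-xs⁻ x∈xs))) (∈-elements⁻ x∈S)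

    ⊆e : elements S ++ xs ⊆ₗ elements e
    ⊆e {x} x∈ with Memₚ.∈-++⁻ (elements S) x∈
    ... | inj₁ x∈S  = ∈-elements⁺ (S⊆e (∈-elements⁻ x∈S))
    ... | inj₂ x∈xs = ∈-elements⁺ (proj₂ (∈-xs⁻ x∈xs) (x∈p∪⁅x⁆ S x))

module _ {n k c} {es : List (Subset n)} (uniform : All (λ e → ∣ e ∣ ≡ k) es) (2k≤n : 2 * k ≤ n)
         (base : ∀ T → ∣ T ∣ + 1 ≡ k → n ≤ c * codegree es T) where

  -- Induction from `(k-1)`-sets down to smaller sets: `S` is extended by each vertex outside it,
  -- and the induction hypothesis is summed over the extensions. At least half of all vertices lie
  -- outside `S`, which costs a factor 2 at each step.
  binomial≤codegree : ∀ j S → ∣ S ∣ + suc j ≡ k → n C suc j ≤ 2 ^ j * c * codegree es S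
  binomial≤codegree zero S ∣S∣+1≡k = begin
    n C 1                 ≡⟨ nC1≡n n ⟩
    n                     ≤⟨ base S ∣S∣+1≡k ⟩
    c * codegree es S     ≡⟨ cong (_* codegree es S) (ℕₚ.*-identityˡ c) ⟨
    1 * c * codegree es S ∎
    where open ℕₚ.≤-Reasoning
  -- The cancelled factor `j + 2` arises on both sides: from the recursion for binomial
  -- coefficients, and from each edge over `S` being counted at most `j + 2` times.
  binomial≤codegree (suc j) S ∣S∣+j+2≡k = ℕₚ.*-cancelˡ-≤ (suc (suc j)) (begin
    suc (suc j) * (n C suc (suc j))                  ≤⟨ [k+1]*nC[k+1]≤n*nCk n (suc j) ⟩
    n * b                                            ≤⟨ ℕₚ.*-monoˡ-≤ b n≤2[n∸s] ⟩
    2 * (n ∸ ∣ S ∣) * b                              ≡⟨ ℕₚ.*-assoc 2 (n ∸ ∣ S ∣) b ⟩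
    2 * ((n ∸ ∣ S ∣) * b)                            ≡⟨ cong (λ l → 2 * (l * b))
                                                           (trans (length-elements (∁ S)) (Subsetₚ.∣∁p∣≡n∸∣p∣ S)) ⟨
    2 * (length xs * b)
      ≤⟨ ℕₚ.*-monoʳ-≤ 2 (length*≤sum (λ x → codegree es (S ∪ ⁅ x ⁆)) {b} {2 ^ j * c} xs extend) ⟩
    2 * (2 ^ j * c * sum (map (λ x → codegree es (S ∪ ⁅ x ⁆)) xs))
                                                     ≤⟨ ℕₚ.*-monoʳ-≤ 2 (ℕₚ.*-monoʳ-≤ (2 ^ j * c) (extensions-≤ uniform S ∣S∣+j+2≡k)) ⟩
    2 * (2 ^ j * c * (suc (suc j) * d))              ≡⟨ ℕₚ.*-assoc 2 (2 ^ j * c) _ ⟨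
    2 * (2 ^ j * c) * (suc (suc j) * d)              ≡⟨ cong (_* (suc (suc j) * d)) (ℕₚ.*-assoc 2 (2 ^ j) c) ⟨
    2 ^ suc j * c * (suc (suc j) * d)                ≡⟨ x∙yz≈y∙xz ℕₚ.*-commutativeSemigroup (2 ^ suc j * c) (suc (suc j)) d ⟩
    suc (suc j) * (2 ^ suc j * c * d)                ∎)
    where
    open ℕₚ.≤-Reasoning
    b = n C suc j
    d = codegree es S
    xs = elements (∁ S)

    s≤k : ∣ S ∣ ≤ k
    s≤k = ℕₚ.≤-trans (ℕₚ.m≤m+n ∣ S ∣ _) (ℕₚ.≤-reflexive ∣S∣+j+2≡k)

    n≤2[n∸s] : n ≤ 2 * (n ∸ ∣ S ∣)
    n≤2[n∸s] = begin
      n                          ≡⟨ ℕₚ.m+n∸n≡m n n ⟨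
      n + n ∸ n                  ≤⟨ ℕₚ.∸-monoʳ-≤ (n + n) (ℕₚ.≤-trans (ℕₚ.*-monoʳ-≤ 2 s≤k) 2k≤n) ⟩
      n + n ∸ 2 * ∣ S ∣          ≡⟨ cong (λ m → n + m ∸ 2 * ∣ S ∣) (ℕₚ.+-identityʳ n) ⟨
      2 * n ∸ 2 * ∣ S ∣          ≡⟨ ℕₚ.*-distribˡ-∸ 2 n ∣ S ∣ ⟨
      2 * (n ∸ ∣ S ∣)            ∎

    extend : ∀ {x} → x ∈ₗ xs → b ≤ 2 ^ j * c * codegree es (S ∪ ⁅ x ⁆)
    extend {x} x∈ = binomial≤codegree j (S ∪ ⁅ x ⁆)
      (trans (cong (_+ suc j) (∣p∪⁅x⁆∣ (Subsetₚ.x∈∁p⇒x∉p (∈-elements⁻ x∈))))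
        (trans (sym (ℕₚ.+-suc ∣ S ∣ (suc j))) ∣S∣+j+2≡k))

-- The painted graph

subset-of-size : ∀ {m n} → m ≤ n → ∃[ S ] ∣_∣ {n} S ≡ m
subset-of-size {n = n} z≤n = ⊥ , Subsetₚ.∣⊥∣≡0 n
subset-of-size (s≤s m≤n)   = let S , eq = subset-of-size m≤n in inside ∷ S , cong suc eq

module _ {κ D} (P : Palette κ D) (m : ℕ) where
  open Palette P

  private
    n : ℕ
    n = m * suc size-1

    -- A vertex is a pair of a copy number and a palette index, so each index occurs on exactly `m`
    -- vertices.
    type : Fin n → Fin (suc size-1)
    type = proj₂ ∘ remQuot {m} (suc size-1)

    paint : Fin n → Tree
    paint = colour ∘ type

    hasApex? : Decidable (λ e → ∃[ y ] OrderedApex D paint e y)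
    hasApex? e = Finₚ.any? (orderedApex? D paint e)

  paintedEdges : List (Subset n)
  paintedEdges = filter hasApex? (subsetsOfSize (suc κ) n)

  paintedEdges-⊆ : paintedEdges Sub.⊆ subsetsOfSize (suc κ) n
  paintedEdges-⊆ = Subₚ.filter-⊆ hasApex? (subsetsOfSize (suc κ) n)

  -- By `dominate`, one palette index `i` suits the colours on `T`, and each of its `m` copies
  -- completes `T` to a different edge.
  copies≤codegree : ∀ T → ∣ T ∣ ≡ κ → m ≤ codegree paintedEdges T
  copies≤codegree T ∣T∣≡κ = begin
    m                                                ≡⟨ Listₚ.length-tabulate {n = m} id ⟨
    length (allFin m)                                ≡⟨ Listₚ.length-map _ (allFin m) ⟨
    length (map (λ q → T ∪ ⁅ vertex q ⁆) (allFin m))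
      ≤⟨ unique⊆⇒length≤ (Uniqueₚ.map⁺ extend-injective (Uniqueₚ.allFin⁺ m)) edges⊆ ⟩
    codegree paintedEdges T                          ∎
    where
    open ℕₚ.≤-Reasoning

    dominated = dominate (map type (elements T))
      (trans (Listₚ.length-map type (elements T)) (trans (length-elements T) ∣T∣≡κ))
    i = proj₁ dominated

    vertex : Fin m → Fin n
    vertex q = combine q i

    paint-vertex : ∀ q → paint (vertex q) ≡ colour i
    paint-vertex q = cong (colour ∘ proj₂) (Finₚ.remQuot-combine q i)

    fresh : ∀ q → All (λ x → label (paint (vertex q)) ∉ₗ labelsTo D (paint x)) (elements T)
    fresh q = subst (λ t → All (λ x → label t ∉ₗ labelsTo D (paint x)) (elements T)) (sym (paint-vertex q))
      (Allₚ.map⁻ (proj₂ (proj₂ dominated)))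

    -- A colour shows its own root label, so a label fresh for all of `T` cannot belong to a vertex
    -- of `T`.
    vertex∉T : ∀ q → vertex q ∉ T
    vertex∉T q y∈T = All.lookup (fresh q) (∈-elements⁺ y∈T) (label∈labelsTo D (paint (vertex q)))

    extend-injective : ∀ {q q′} → T ∪ ⁅ vertex q ⁆ ≡ T ∪ ⁅ vertex q′ ⁆ → q ≡ q′
    extend-injective {q} {q′} eq
      with Subsetₚ.x∈p∪q⁻ T ⁅ vertex q′ ⁆ (subst (vertex q ∈_) eq (x∈p∪⁅x⁆ T (vertex q)))
    ... | inj₁ y∈T = contradiction y∈T (vertex∉T q)
    ... | inj₂ y∈  = Finₚ.combine-injectiveˡ q i q′ i (Subsetₚ.x∈⁅y⁆⇒x≡y (vertex q′) y∈)

    apex : ∀ q → OrderedApex D paint (T ∪ ⁅ vertex q ⁆) (vertex q)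
    apex q rewrite [p∪⁅x⁆]-x≡p (vertex∉T q) = x∈p∪⁅x⁆ T (vertex q) ,
      trans (cong children (paint-vertex q))
        (trans (proj₁ (proj₂ dominated)) (sym (Listₚ.map-∘ (elements T)))) ,
      fresh q

    edges⊆ : map (λ q → T ∪ ⁅ vertex q ⁆) (allFin m) ⊆ₗ filter (T Subsetₚ.⊆?_) paintedEdges
    edges⊆ e∈ with q , _ , refl ← Memₚ.∈-map⁻ (λ q → T ∪ ⁅ vertex q ⁆) e∈ =
      Memₚ.∈-filter⁺ (T Subsetₚ.⊆?_)
        (Memₚ.∈-filter⁺ hasApex? (∈-subsetsOfSize⁺ (trans (∣p∪⁅x⁆∣ (vertex∉T q)) (cong suc ∣T∣≡κ))) (vertex q , apex q))
        (Subsetₚ.p⊆p∪q ⁅ vertex q ⁆)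

  -- `H` is constrained only through its edge list, since the graph found in the enumeration is
  -- known only by its edges.
  contained⇒layered : ∀ {v} (F : KGraph (suc κ) v) → v * v + v * v ≤ D →
                      (H : KGraph (suc κ) n) → edges H ≡ paintedEdges → Contains H F → Layered F
  contained⇒layered {v} F 2v²≤D H edges≡ (φ , embedding φ-inj pres) = layered-of-apices F (paint ∘ φ) 2v²≤D apex
    where
    apex : ∀ {e} → e ∈ᴱ F → ∃[ y ] IsApex D (paint ∘ φ) e y
    apex {e} e∈F
      with y , ap ← proj₂ (Memₚ.∈-filter⁻ hasApex? {xs = subsetsOfSize (suc κ) n}
                     (subst (image φ e ∈ₗ_) edges≡ (All.lookup pres e∈F)))
      -- The apex belongs to the image of `e`, so it is the image of a vertex of `F`.
      with x , _ , refl ← ∈-image⁻ φ (proj₁ ap) = x , orderedApex⇒isApex φ φ-inj ap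

-- From degrees in an enumerated graph to the degree density

∈-sublists : ∀ {A : Set} {xs ys : List A} → ys Sub.⊆ xs → ∃[ τ ] (ys , τ) ∈ₗ sublists xs
∈-sublists Sub.[] = _ , here refl
∈-sublists {xs = x ∷ xs} (_ Sub.∷ʳ τ) =
  let _ , τ∈ = ∈-sublists τ in _ , Memₚ.∈-++⁺ʳ (map _ (sublists xs)) (Memₚ.∈-map⁺ _ τ∈)
∈-sublists {xs = x ∷ xs} (refl Sub.∷ τ) =
  let _ , τ∈ = ∈-sublists τ in _ , Memₚ.∈-++⁺ˡ (Memₚ.∈-map⁺ _ τ∈)

∈-kGraphs : ∀ {k n es} → es Sub.⊆ subsetsOfSize k n → ∃[ H ] (H ∈ₗ kGraphs k n × edges H ≡ es)
∈-kGraphs τ = let _ , τ∈ = ∈-sublists τ in _ , Memₚ.∈-map⁺ _ τ∈ , refl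

minDegree-attained : ∀ {k n ℓ} (H : KGraph k n) → ℓ ≤ n → ∃[ S ] (∣ S ∣ ≡ ℓ × degree H S ≤ minDegree ℓ H)
minDegree-attained {n = n} {ℓ} H ℓ≤n
  with argmin-sel id (length (edges H)) (map (degree H) (subsetsOfSize ℓ n))
-- Here the minimum is its default, the number of edges, which bounds the degree of every set; `ℓ≤n`
-- supplies some `ℓ`-set.
... | inj₁ min≡ = let S , eq = subset-of-size ℓ≤n in
  S , eq , ℕₚ.≤-trans (Listₚ.length-filter (S Subsetₚ.⊆?_) (edges H)) (ℕₚ.≤-reflexive (sym min≡))
... | inj₂ min∈ = let S , S∈ , eq = Memₚ.∈-map⁻ (degree H) min∈ in
  S , ∈-subsetsOfSize⁻ S∈ , ℕₚ.≤-reflexive (sym eq)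

minDegree≤ex : ∀ {k v n ℓ} {F : KGraph k v} {H : KGraph k n} →
               H ∈ₗ kGraphs k n → Free F H → minDegree ℓ H ≤ ex ℓ n F
minDegree≤ex {ℓ = ℓ} {F} H∈ free =
  v≤max⁺ 0 _ (inj₂ (lose (Memₚ.∈-map⁺ (minDegree ℓ) (Memₚ.∈-filter⁺ (free? F) H∈ free)) ℕₚ.≤-refl))

-- Unnormalised fractions are compared by cross-multiplication. Positivity of `b` excludes the
-- default value 0 of `ratio`.
1/c≤ratio : ∀ {a b c} → 0 < b → b ≤ suc c * a → ℤ.+ 1 ℚ./ suc c ℚ.≤ ratio a b
1/c≤ratio {a} {suc b} {c} _ b≤ca = ℚₚ.toℚᵘ-cancel-≤ (begin
  ℚ.toℚᵘ (ℤ.+ 1 ℚ./ suc c) ≃⟨ ℚₚ.toℚᵘ-fromℚᵘ (ℚᵘ.mkℚᵘ (ℤ.+ 1) c) ⟩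
  ℚᵘ.mkℚᵘ (ℤ.+ 1) c       ≤⟨ ℚᵘ.*≤* (subst₂ ℤ._≤_ (sym (ℤₚ.*-identityˡ (ℤ.+ suc b)))
    (trans (cong ℤ.+_ (ℕₚ.*-comm (suc c) a)) (ℤₚ.pos-* a (suc c))) (ℤ.+≤+ b≤ca)) ⟩
  ℚᵘ.mkℚᵘ (ℤ.+ a) b       ≃⟨ ℚₚ.toℚᵘ-fromℚᵘ (ℚᵘ.mkℚᵘ (ℤ.+ a) b) ⟨
  ℚ.toℚᵘ (ℤ.+ a ℚ./ suc b) ∎)
  where open ℚᵘₚ.≤-Reasoning

corollary2 : (k ℓ : ℕ) → 3 ≤ k → 1 ≤ ℓ → ℓ ≤ k ∸ 1 →
    (v : ℕ) (F : KGraph k v) →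
    HasTuránDensity ℓ F 0ℚ → Layered F
corollary2 (suc κ) ℓ _ _ ℓ≤κ v F vanishing = decide (contains? F H)
  where
  P : Palette κ (v * v + v * v)
  P = palette κ (v * v + v * v)
  N = suc (Palette.size-1 P)

  -- An `ℓ`-set is `j` vertices short of a `(k-1)`-set. The constant `c` is the factor `N` for
  -- `(k-1)`-sets, doubled in each of the `j` induction steps.
  j = κ ∸ ℓ
  c = 2 ^ j * N

  k∸ℓ≡1+j : suc κ ∸ ℓ ≡ suc j
  k∸ℓ≡1+j = ℕₚ.+-∸-assoc 1 ℓ≤κ

  ε = ℤ.+ 1 ℚ./ suc c

  0<ε : 0ℚ ℚ.< ε
  0<ε = ℚₚ.positive⁻¹ ε {{ℚₚ.normalize-pos 1 (suc c)}}

  threshold = vanishing ε 0<ε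

  -- Large enough for `n` both to pass the threshold of convergence and to be at least `2k`, as the
  -- codegree induction requires.
  m = proj₁ threshold + 2 * suc κ
  n = m * N
  m≤n : m ≤ n
  m≤n = ℕₚ.m≤m*n m N

  2k≤n : 2 * suc κ ≤ n
  2k≤n = ℕₚ.≤-trans (ℕₚ.m≤n+m (2 * suc κ) (proj₁ threshold)) m≤n

  k≤n : suc κ ≤ n
  k≤n = ℕₚ.≤-trans (ℕₚ.m≤n*m (suc κ) 2) 2k≤n

  painted = ∈-kGraphs (paintedEdges-⊆ P m)
  H = proj₁ painted
  edges≡ = proj₂ (proj₂ painted)

  base : ∀ T → ∣ T ∣ + 1 ≡ suc κ → n ≤ N * codegree (edges H) T
  base T ∣T∣+1≡k = begin
    m * N                             ≡⟨ ℕₚ.*-comm m N ⟩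
    N * m                             ≤⟨ ℕₚ.*-monoʳ-≤ N (copies≤codegree P m T
                                           (ℕₚ.suc-injective (trans (ℕₚ.+-comm 1 ∣ T ∣) ∣T∣+1≡k))) ⟩
    N * codegree (paintedEdges P m) T ≡⟨ cong (λ es → N * codegree es T) edges≡ ⟨
    N * codegree (edges H) T          ∎
    where open ℕₚ.≤-Reasoning

  binomial≤minDegree : n C (suc κ ∸ ℓ) ≤ c * minDegree ℓ H
  binomial≤minDegree =
    let S , ∣S∣≡ℓ , attained = minDegree-attained {ℓ = ℓ} H (ℕₚ.≤-trans (ℕₚ.m≤n⇒m≤1+n ℓ≤κ) k≤n)
    in begin
    n C (suc κ ∸ ℓ)        ≡⟨ cong (n C_) k∸ℓ≡1+j ⟩
    n C suc j              ≤⟨ binomial≤codegree (uniform H) 2k≤n base j S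
                               (trans (cong₂ _+_ ∣S∣≡ℓ (sym k∸ℓ≡1+j)) (ℕₚ.m+[n∸m]≡n (ℕₚ.m≤n⇒m≤1+n ℓ≤κ))) ⟩
    c * codegree (edges H) S ≤⟨ ℕₚ.*-monoʳ-≤ c attained ⟩
    c * minDegree ℓ H      ∎
    where open ℕₚ.≤-Reasoning

  r = ratio (ex ℓ n F) (n C (suc κ ∸ ℓ))

  decide : Dec (Contains H F) → Layered F
  decide (yes contains) = contained⇒layered P m F ℕₚ.≤-refl H edges≡ contains
  -- If `H` were `F`-free, its minimum degree would bound `ex` from below and keep the ratio at
  -- least `ε`, although `n` is beyond the threshold for `ε`.
  decide (no free) = contradiction (ℚₚ.<-≤-trans r<ε ε≤r) (ℚₚ.<-irrefl refl)
    where
    ε≤r : ε ℚ.≤ r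
    ε≤r = 1/c≤ratio {c = c} (0<nCk (ℕₚ.≤-trans (ℕₚ.m∸n≤m (suc κ) ℓ) k≤n)) (begin
      n C (suc κ ∸ ℓ)      ≤⟨ binomial≤minDegree ⟩
      c * minDegree ℓ H    ≤⟨ ℕₚ.*-mono-≤ (ℕₚ.n≤1+n c) (minDegree≤ex {ℓ = ℓ} {F} {H} (proj₁ (proj₂ painted)) free) ⟩
      suc c * ex ℓ n F     ∎)
      where open ℕₚ.≤-Reasoning

    ∣r-0∣≡r : ℚ.∣ r ℚ.- 0ℚ ∣ ≡ r
    ∣r-0∣≡r = trans (cong ℚ.∣_∣ (ℚₚ.+-identityʳ r)) (ℚₚ.0≤p⇒∣p∣≡p (ℚₚ.≤-trans (ℚₚ.<⇒≤ 0<ε) ε≤r))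

    r<ε : r ℚ.< ε
    r<ε = subst (ℚ._< ε) ∣r-0∣≡r (proj₂ threshold n (ℕₚ.≤-trans (ℕₚ.m≤m+n (proj₁ threshold) _) m≤n))
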